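{- For every field $\mathbb{F}$, all $n,d\ge1$ and every tensor $A:[n]^{2d}\to\mathbb{F}$, we have $\mathcal L_{\mathsf{nc,sm}}(A^\flat)\ge n^{\log_2 d}\,\rho(A)$.
   Context: For $a,b\in\{0,1\}$ and $\alpha\in\{0,1\}^{d-1}$ define the partition $I_{a,\alpha,b}\sqcup J_{a,\alpha,b}=[2d]$ by $I_{a,\alpha,b}=[2d]\cap\{a,\,2+\alpha_1,\,4+\alpha_2,\dots,2d-2+\alpha_{d-1},\,2d+b\}$ and $J_{a,\alpha,b}=[2d]\cap\{1-a,\,3-\alpha_1,\,5-\alpha_2,\dots,2d-1-\alpha_{d-1},\,2d+1-b\}$. For $A:[n]^{2d}\to\mathbb{F}$ and a partition $I\sqcup J=[2d]$, $\mathrm{Mat}_{I,J}(A)$ is the $n^{|I|}\times n^{|J|}$ flattening (rows indexed by coordinates in $I$, columns by those in $J$). $\mathrm{relrk}_{a,\alpha,b}(A)=n^{ -d}\mathrm{rank}(\mathrm{Mat}_{I_{a,\alpha,b},J_{a,\alpha,b}}(A))$, and \[\rho(A)=\max_{a,b\in\{0,1\}}\ \min_{\{X_\alpha\}}\ \sum_{\alpha\in\{0,1\}^{d-1}}\mathrm{relrk}_{a,\alpha,b}(X_\alpha),\] the minimum over families of tensors $X_\alpha:[n]^{2d}\to\mathbb{F}$ with $A=\sum_\alpha X_\alpha$. The flattening $A^\flat:[n^2]^d\to\mathbb{F}$ is $A^\flat(\langle a_1,b_1\rangle,\dots,\langle a_d,b_d\rangle)=A(a_1,b_1,\dots,a_d,b_d)$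 with $\langle a,b\rangle=(a-1)n+b$. Non-commutative set-multilinear formula size of $B:[N]^k\to\mathbb{F}$: if $k=1$, $\mathcal L_{\mathsf{nc,sm}}(B)=1$ if $B\ne0$ and $0$ otherwise; if $k\ge2$ it is the minimum of $\sum_i(\mathcal L_{\mathsf{nc,sm}}(B_i)+\mathcal L_{\mathsf{nc,sm}}(C_i))$ over finite families with positive $e_i+f_i=k$, $B_i:[N]^{e_i}\to\mathbb{F}$, $C_i:[N]^{f_i}\to\mathbb{F}$, $B=\sum_iB_i\otimes C_i$ (concatenating coordinates in order). -}

module Defs where

open import Level using (Level; Lift) renaming (_⊔_ to _⊔ˡ_)
open import Algebra.Apartness.Bundles using (HeytingCommutativeRing; HeytingField)
open import Algebra.Bundles using (CommutativeRing)
import Algebra.Properties.Monoid.Sum as MonoidSum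
open import Data.Bool.Base using (Bool; true; false; not; _∨_)
open import Data.Empty.Polymorphic using (⊥)
open import Data.Fin.Base using (Fin; zero; suc; toℕ; quotient; remainder)
open import Data.Fin.Patterns using (0F; 1F)
open import Data.Fin.Subset using (Subset; inside; outside; ∁; ∣_∣)
open import Data.Integer.Base as ℤ using ()
open import Data.List.Base as List using (List; []; _∷_)
open import Data.List.Membership.DecPropositional as DecMembership using ()
open import Data.Nat.Base as ℕ using (ℕ; zero; suc; pred; NonZero; _<_)
import Data.Nat.Properties as ℕ
open import Data.Nat.Induction using (Acc; acc; <-wellFounded)
open import Data.Product.Base using (Σ-syntax; ∃-syntax; _×_; _,_)
open import Data.Rational.Base as ℚ using (ℚ)
open import Algebra.Definitions.RawSemiring ℚ.+-*-rawSemiring using () renaming (_^_ to _^ℚ_)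
open import Data.Sum.Base using (_⊎_)
open import Data.Vec.Base as Vec using (Vec; []; _∷_; lookup)
open import Relation.Binary.Core using (Rel)
open import Relation.Binary.PropositionalEquality using (_≡_; refl; cong; cong₂; sym; trans; subst)
open import Relation.Nullary using (¬_; does)

private variable
  a ℓ ℓ′ : Level
  X : Set a
  d k m n : ℕ

IsMinimum : {X : Set a} → Rel X ℓ → (X → Set ℓ′) → X → Set (a ⊔ˡ ℓ ⊔ˡ ℓ′)
IsMinimum _≤_ P x = P x × (∀ y → P y → x ≤ y)

IsMaximum : {X : Set a} → Rel X ℓ → (X → Set ℓ′) → X → Set (a ⊔ˡ ℓ ⊔ˡ ℓ′)
IsMaximum _≤_ P x = P x × (∀ y → P y → y ≤ x)

-- The sum of f α over all α ∈ {0,1}ᵏ.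
sumBits : (X → X → X) → (Vec (Fin 2) k → X) → X
sumBits {k = zero}  _⊕_ f = f []
sumBits {k = suc k} _⊕_ f = sumBits _⊕_ (λ α → f (0F ∷ α)) ⊕ sumBits _⊕_ (λ α → f (1F ∷ α))

-- An element j of Fin m stands for the element 1 + j of [m].
[_]∩_ : (m : ℕ) → List ℕ → Subset m
[ m ]∩ xs = Vec.tabulate (λ j → does (suc (toℕ j) ∈? xs))
  where open DecMembership ℕ._≟_ using (_∈?_)

-- The set written [2d] in the mathematics is Fin (d * 2) here.
I : (d : ℕ) → Fin 2 → Vec (Fin 2) (pred d) → Fin 2 → Subset (d ℕ.* 2)
I d a α b = [ d ℕ.* 2 ]∩
  ( toℕ a
  ∷ List.tabulate (λ i → 2 ℕ.* suc (toℕ i) ℕ.+ toℕ (lookup α i))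
  List.++ List.[ 2 ℕ.* d ℕ.+ toℕ b ])

J : (d : ℕ) → Fin 2 → Vec (Fin 2) (pred d) → Fin 2 → Subset (d ℕ.* 2)
J d a α b = [ d ℕ.* 2 ]∩
  ( (1 ℕ.∸ toℕ a)
  ∷ List.tabulate (λ i → 2 ℕ.* suc (toℕ i) ℕ.+ 1 ℕ.∸ toℕ (lookup α i))
  List.++ List.[ 2 ℕ.* d ℕ.+ 1 ℕ.∸ toℕ b ])

-- I and J partition [2d].  Positions 0 and 2d + 1 also lie in exactly one of
-- the two lists, which makes the induction uniform.
module Partition where
  open import Data.Fin.Properties using (toℕ<n)
  import Data.List.Properties as List
  import Data.Vec.Properties as Vec
  open import Data.Nat.Base using (_+_; _*_; _∸_; _≤_; z≤n; s≤s)
  open import Function.Base using (_∘_)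
  open DecMembership ℕ._≟_ using (_∈?_)
  open import Data.Nat.Properties using (_≟_; *-suc; *-comm; +-∸-assoc; ≤-pred; ≤-trans; ≤-reflexive; m≤m+n)

  listI : ∀ k → ℕ → (Fin k → Fin 2) → Fin 2 → List ℕ
  listI k a α b = a ∷ List.tabulate (λ i → 2 * suc (toℕ i) + toℕ (α i)) List.++ List.[ 2 * suc k + toℕ b ]
  listJ : ∀ k → ℕ → (Fin k → Fin 2) → Fin 2 → List ℕ
  listJ k a α b = a ∷ List.tabulate (λ i → 2 * suc (toℕ i) + 1 ∸ toℕ (α i)) List.++ List.[ 2 * suc k + 1 ∸ toℕ b ]

  listI-suc : ∀ k a (α : Fin (suc k) → Fin 2) b →
    listI (suc k) a α b ≡ a ∷ List.map (2 +_) (listI k (toℕ (α zero)) (α ∘ suc) b)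
  listI-suc k a α b = cong (a ∷_) (cong (_ ∷_) (trans (cong₂ List._++_
      (trans (List.tabulate-cong (λ i → cong (_+ toℕ (α (suc i))) (*-suc 2 (suc (toℕ i))))) (sym (List.map-tabulate _ (2 +_))))
      (cong (λ z → List.[ z + toℕ b ]) (*-suc 2 (suc k))))
    (sym (List.map-++ (2 +_) (List.tabulate (λ i → 2 * suc (toℕ i) + toℕ (α (suc i)))) List.[ 2 * suc k + toℕ b ]))))

  ∸-suc : ∀ m (x : Fin 2) → 2 * suc (suc m) + 1 ∸ toℕ x ≡ 2 + (2 * suc m + 1 ∸ toℕ x)
  ∸-suc m x = trans (cong (λ z → z + 1 ∸ toℕ x) (*-suc 2 (suc m))) (+-∸-assoc 2 (le x))
    where le : ∀ x → toℕ x ≤ 2 * suc m + 1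
          le 0F = z≤n
          le 1F = s≤s z≤n

  listJ-suc : ∀ k a (α : Fin (suc k) → Fin 2) b →
    listJ (suc k) a α b ≡ a ∷ List.map (2 +_) (listJ k (1 ∸ toℕ (α zero)) (α ∘ suc) b)
  listJ-suc k a α b = cong (a ∷_) (cong₂ List._∷_ (h (α zero)) (trans (cong₂ List._++_
      (trans (List.tabulate-cong (λ i → ∸-suc (toℕ i) (α (suc i)))) (sym (List.map-tabulate _ (2 +_))))
      (cong List.[_] (∸-suc k b)))
    (sym (List.map-++ (2 +_) (List.tabulate (λ i → 2 * suc (toℕ i) + 1 ∸ toℕ (α (suc i)))) List.[ 2 * suc k + 1 ∸ toℕ b ]))))
    where h : ∀ x → 3 ∸ toℕ x ≡ 2 + (1 ∸ toℕ x)
          h 0F = refl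
          h 1F = refl

  mem : ℕ → List ℕ → Bool
  mem p xs = does (p ∈? xs)

  mem+2 : ∀ p xs → mem (2 + p) (List.map (2 +_) xs) ≡ mem p xs
  mem+2 p [] = refl
  mem+2 p (x ∷ xs) = cong (does (p ≟ x) ∨_) (mem+2 p xs)
  mem1 : ∀ xs → mem 1 (List.map (2 +_) xs) ≡ false
  mem1 [] = refl
  mem1 (x ∷ xs) = mem1 xs
  mem0 : ∀ xs → mem 0 (List.map (2 +_) xs) ≡ false
  mem0 [] = refl
  mem0 (x ∷ xs) = mem0 xs

  mem-J : ∀ k (a : Fin 2) α b p → p ≤ 2 * suc k + 1 → mem p (listJ k (1 ∸ toℕ a) α b) ≡ not (mem p (listI k (toℕ a) α b))
  mem-J zero 0F α 0F 0 _ = refl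
  mem-J zero 0F α 0F 1 _ = refl
  mem-J zero 0F α 0F 2 _ = refl
  mem-J zero 0F α 0F 3 _ = refl
  mem-J zero 0F α 1F 0 _ = refl
  mem-J zero 0F α 1F 1 _ = refl
  mem-J zero 0F α 1F 2 _ = refl
  mem-J zero 0F α 1F 3 _ = refl
  mem-J zero 1F α 0F 0 _ = refl
  mem-J zero 1F α 0F 1 _ = refl
  mem-J zero 1F α 0F 2 _ = refl
  mem-J zero 1F α 0F 3 _ = refl
  mem-J zero 1F α 1F 0 _ = refl
  mem-J zero 1F α 1F 1 _ = refl
  mem-J zero 1F α 1F 2 _ = refl
  mem-J zero 1F α 1F 3 _ = refl
  mem-J zero a α b (suc (suc (suc (suc _)))) (s≤s (s≤s (s≤s ())))
  mem-J (suc k) a α b p p≤ =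
    trans (cong (mem p) (listJ-suc k (1 ∸ toℕ a) α b))
          (trans (go a p p≤) (cong (λ xs → not (mem p xs)) (sym (listI-suc k (toℕ a) α b))))
    where
    u = listI k (toℕ (α zero)) (α ∘ suc) b
    v = listJ k (1 ∸ toℕ (α zero)) (α ∘ suc) b
    rec : ∀ q → 2 + q ≤ 2 * suc (suc k) + 1 → mem (2 + q) (List.map (2 +_) v) ≡ not (mem (2 + q) (List.map (2 +_) u))
    rec q q≤ rewrite mem+2 q u | mem+2 q v = mem-J k (α zero) (α ∘ suc) b q
      (≤-pred (≤-pred (≤-trans q≤ (≤-reflexive (cong (_+ 1) (*-suc 2 (suc k)))))))
    go : ∀ (a : Fin 2) p → p ≤ 2 * suc (suc k) + 1 → mem p ((1 ∸ toℕ a) ∷ List.map (2 +_) v) ≡ not (mem p (toℕ a ∷ List.map (2 +_) u))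
    go 0F 0 _ rewrite mem0 v = refl
    go 1F 0 _ rewrite mem0 u = refl
    go 0F 1 _ rewrite mem1 u = refl
    go 1F 1 _ rewrite mem1 v = refl
    go 0F (suc (suc q)) q≤ = rec q q≤
    go 1F (suc (suc q)) q≤ = rec q q≤

  J≡∁I : ∀ d .{{_ : NonZero d}} a α b → J d a α b ≡ ∁ (I d a α b)
  J≡∁I d@(suc k) a α b = trans
    (Vec.tabulate-cong {f = λ j → pos (listJ k (1 ∸ toℕ a) (lookup α) b) j} {g = λ j → not (pos xs j)}
      λ j → mem-J k a (lookup α) b (suc (toℕ j))
      (≤-trans (toℕ<n j) (≤-trans (≤-reflexive (*-comm d 2)) (m≤m+n (2 * d) 1))))
    (Vec.tabulate-∘ not (pos xs))
    where
    pos : List ℕ → Fin (d * 2) → Bool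
    pos zs j = mem (suc (toℕ j)) zs
    xs = listI k (toℕ a) (lookup α) b

open Partition public using (J≡∁I)

-- merge I u v is the tuple whose I-coordinates are u and whose other
-- coordinates are v, both in increasing order of position.  By J≡∁I, the columns
-- of a flattening are indexed by v.
merge : (I : Subset m) → Vec X ∣ I ∣ → Vec X ∣ ∁ I ∣ → Vec X m
merge []            []      []      = []
merge (inside  ∷ I) (x ∷ u) v       = x ∷ merge I u v
merge (outside ∷ I) u       (x ∷ v) = x ∷ merge I u v

-- Classically, Heyting fields (with x # y being x ≉ y) are exactly fields.  Ranks,
-- ρ and formula sizes are not computable over such an F, so each is given by its
-- graph: IsRank M r says rank M = r, and likewise IsRelrk, Isρ and IsSize.
module _ {c ℓ₁ ℓ₂} (F : HeytingField c ℓ₁ ℓ₂) where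

  open HeytingField F using (Carrier; _≈_; _+_; _*_; 0#; heytingCommutativeRing)
  open CommutativeRing (HeytingCommutativeRing.commutativeRing heytingCommutativeRing)
    using (+-monoid)
  open MonoidSum +-monoid using (sum)

  Tensor : ℕ → ℕ → Set c
  Tensor N k = Vec (Fin N) k → Carrier

  Matrix : Set → Set → Set c
  Matrix R C = R → C → Carrier

  IndependentColumns : {R C : Set} → Matrix R C → (r : ℕ) → (Fin r → C) → Set (c ⊔ˡ ℓ₁)
  IndependentColumns M r σ =
    (t : Fin r → Carrier) → (∀ x → sum (λ i → t i * M x (σ i)) ≈ 0#) → ∀ i → t i ≈ 0#

  -- The rank is the largest number of linearly independent columns.
  IsRank : {R C : Set} → Matrix R C → ℕ → Set (c ⊔ˡ ℓ₁)
  IsRank M = IsMaximum ℕ._≤_ (λ r → ∃[ σ ] IndependentColumns M r σ)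

  Mat : (I : Subset m) → Tensor n m → Matrix (Vec (Fin n) ∣ I ∣) (Vec (Fin n) ∣ ∁ I ∣)
  Mat I A u v = A (merge I u v)

  IsRelrk : ∀ d .{{_ : NonZero n}} → Fin 2 → Vec (Fin 2) (pred d) → Fin 2 →
            Tensor n (d ℕ.* 2) → ℚ → Set (c ⊔ˡ ℓ₁)
  IsRelrk {n = n} d a α b A x =
    ∃[ r ] IsRank (Mat (I d a α b) A) r × x ≡ ℚ._/_ (ℤ.+ r) (n ℕ.^ d) {{ℕ.m^n≢0 n d}}

  -- x = ∑_α relrk_{a,α,b}(X_α) for some decomposition A = ∑_α X_α.
  IsRelrkSum : ∀ d .{{_ : NonZero n}} → Fin 2 → Fin 2 → Tensor n (d ℕ.* 2) → ℚ → Set (c ⊔ˡ ℓ₁)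
  IsRelrkSum {n = n} d a b A x =
    Σ[ X ∈ (Vec (Fin 2) (pred d) → Tensor n (d ℕ.* 2)) ]
    Σ[ y ∈ (Vec (Fin 2) (pred d) → ℚ) ]
      (∀ v → A v ≈ sumBits _+_ (λ α → X α v))
      × (∀ α → IsRelrk d a α b (X α) (y α))
      × x ≡ sumBits ℚ._+_ y

  Isρ : ∀ d .{{_ : NonZero n}} → Tensor n (d ℕ.* 2) → ℚ → Set (c ⊔ˡ ℓ₁)
  Isρ d A ρ =
    Σ[ x ∈ (Fin 2 → Fin 2 → ℚ) ]
      (∀ a b → IsMinimum ℚ._≤_ (IsRelrkSum d a b A) (x a b))
      × ρ ≡ (x 0F 0F ℚ.⊔ x 0F 1F) ℚ.⊔ (x 1F 0F ℚ.⊔ x 1F 1F)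

  -- With 0-based indices the pairing is ⟨a,b⟩ = a n + b, whose inverse is
  -- (quotient, remainder).
  flat : ∀ d → Tensor n (d ℕ.* 2) → Tensor (n ℕ.* n) d
  flat {n = n} d A v =
    A (Vec.concat (Vec.map (λ i → quotient n i ∷ remainder {n} n i ∷ []) v))

  record Product (N k : ℕ) : Set c where
    field
      e f : ℕ
      {{e>0}} : NonZero e
      {{f>0}} : NonZero f
      e+f≡k : e ℕ.+ f ≡ k
      B : Tensor N e
      C : Tensor N f

    B⊗C : Tensor N k
    B⊗C v = B (Vec.take e w) * C (Vec.drop e w)
      where w = Vec.cast (sym e+f≡k) v

    e<k : e < k
    e<k = subst (e <_) e+f≡k (ℕ.m<m+n e (ℕ.>-nonZero⁻¹ f))

    f<k : f < k
    f<k = subst (f <_) e+f≡k (ℕ.m<n+m f (ℕ.>-nonZero⁻¹ e))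

  -- Recursion on the order k; there is no value at order 0.
  IsSize′ : ∀ {N} k → Acc _<_ k → Tensor N k → ℕ → Set (c ⊔ˡ ℓ₁)
  IsSize′ 0 _ B s = ⊥
  IsSize′ 1 _ B s = Lift c (((¬ (∀ v → B v ≈ 0#)) × s ≡ 1) ⊎ ((∀ v → B v ≈ 0#) × s ≡ 0))
  IsSize′ {N} k@(suc (suc _)) (acc rs) A = IsMinimum ℕ._≤_ λ s →
    ∃[ m ] Σ[ P ∈ (Fin m → Product N k) ] Σ[ x ∈ (Fin m → ℕ) ] Σ[ y ∈ (Fin m → ℕ) ]
      (∀ v → A v ≈ sum (λ i → Product.B⊗C (P i) v))
      × (∀ i → let open Product (P i) in
                 IsSize′ e (rs e<k) B (x i) × IsSize′ f (rs f<k) C (y i))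
      × s ≡ sumℕ (λ i → x i ℕ.+ y i)
    where open MonoidSum ℕ.+-0-monoid using () renaming (sum to sumℕ)

  -- The non-commutative set-multilinear formula size 𝓛_{nc,sm}.
  IsSize : ∀ {N k} → Tensor N k → ℕ → Set (c ⊔ˡ ℓ₁)
  IsSize {k = k} = IsSize′ k (<-wellFounded k)

-- The inequality n^(log₂ d) x ≤ y between real numbers, for n, d ≥ 1 and
-- x, y ≥ 0.  Since n ≥ 1, the real power n^(log₂ d) is the supremum of n^(p/q)
-- over the rationals 0 ≤ p/q ≤ log₂ d, i.e. those with 2ᵖ ≤ d^q; and
-- n^(p/q) x ≤ y is nᵖ x^q ≤ y^q.
_^log₂_·_≤_ : ℕ → ℕ → ℚ → ℚ → Set
n ^log₂ d · x ≤ y = ∀ p q → .{{NonZero q}} → 2 ℕ.^ p ℕ.≤ d ℕ.^ q →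
  ℚ._/_ (ℤ.+ (n ℕ.^ p)) 1 ℚ.* x ^ℚ q ℚ.≤ y ^ℚ q

{-# OPTIONS --safe #-}

module Submission where

-- We prove the integral strengthening n^⌈log₂ d⌉ · R ≤ L · n^d, where R is the number of
-- rank-one terms (each tagged with the α of the flattening in which it has rank one)
-- in a decomposition of A for given a, b.  By induction along the formula: in a
-- product B ⊗ C with orders e + f = d, say with e ≥ f, decompose B by induction for
-- (a, c), where c ≠ b.  A flattening of C for (c, b) has n^(f-1) rows or
-- columns, so C is a sum of n^(f-1) rank-one terms with one arbitrary tag.  The products
-- of terms are terms for (a, b), as c becomes the bit of α between the two
-- factors.  This wins a factor n over the trivial bound n^f on the rank of C, while
-- ⌈log₂ d⌉ ≤ ⌈log₂ 2e⌉ = 1 + ⌈log₂ e⌉.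

open import Defs
open import Algebra.Apartness.Bundles using (HeytingCommutativeRing; HeytingField)
import Algebra.Apartness.Properties.HeytingCommutativeRing as HeytingProperties
open import Algebra.Bundles using (CommutativeMonoid; CommutativeRing)
import Algebra.Properties.CommutativeSemigroup as CSemigroup
import Algebra.Properties.CommutativeSemiring.Exp as Exp
import Algebra.Properties.Monoid.Sum as MonoidSum
import Algebra.Properties.Ring as RingProperties
import Algebra.Properties.Semiring.Sum as SemiringSum
open import Data.Bool.Base using (Bool; true; false; if_then_else_)
open import Data.Fin.Base as Fin using (Fin; zero; suc; toℕ; quotient; remainder; combine; punchIn)
open import Data.Fin.Patterns using (0F; 1F)
import Data.Fin.Properties as Fin
open import Data.Fin.Subset using (Subset; inside; outside; ∁; ∣_∣)
open import Data.Integer.Base as ℤ using (+_)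
import Data.Integer.Properties as ℤ
open import Data.List.Base as List using (List; []; _∷_; _++_; length; filter; cartesianProductWith)
import Data.List.Properties as List
open import Data.List.Relation.Unary.All as All using (All; []; _∷_)
open import Data.List.Relation.Unary.All.Properties using (all-filter)
open import Data.Nat.Base as ℕ using (ℕ; zero; suc; NonZero; z≤n; s≤s)
open import Data.Nat.Induction using (Acc; acc; <-rec; <-wellFounded)
open import Data.Nat.Logarithm using (⌈log₂_⌉; ⌈log₂⌉-mono-≤; ⌈log₂⌈n/2⌉⌉≡⌈log₂n⌉∸1; ⌈log₂2*n⌉≡1+⌈log₂n⌉)
import Data.Nat.Properties as ℕ
open import Data.Nat.Solver using (module +-*-Solver)
open import Data.Product.Base using (∃-syntax; Σ-syntax; _×_; _,_; proj₁; proj₂)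
open import Data.Rational.Base as ℚ using (ℚ; _/_; 0ℚ; 1ℚ)
import Data.Rational.Properties as ℚ
import Data.Rational.Unnormalised.Base as ℚᵘ
import Data.Rational.Unnormalised.Properties as ℚᵘ
open import Data.Sum.Base using (_⊎_; inj₁; inj₂)
open import Data.Unit.Polymorphic.Base using (⊤; tt)
open import Data.Vec.Base as Vec using (Vec; []; _∷_; lookup)
open import Data.Vec.Functional using (insertAt)
open import Data.Vec.Functional.Properties using (insertAt-lookup; insertAt-punchIn)
import Data.Vec.Properties as Vec
open import Function.Base using (_∘_)
open import Level using (Level; lift)
open import Relation.Binary.PropositionalEquality using (_≡_; refl; cong; cong₂; sym; trans; subst; subst₂)
import Relation.Binary.Reasoning.Setoid as ≈-Reasoning
open import Relation.Nullary using (Dec; ¬_; does; yes; no; contradiction)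
open import Relation.Nullary.Decidable.Core using (¬¬-excluded-middle; decidable-stable)

open Partition using (listI; listI-suc; mem; mem+2; mem0; mem1)
open Exp (CommutativeRing.commutativeSemiring ℚ.+-*-commutativeRing) using (_^_; ^-distrib-*)
open +-*-Solver using (solve; _:*_; _:=_)

private variable
  a : Level
  A B X Y Z : Set a
  k m n : ℕ

-- The partition of the positions

isOne isZero : Fin 2 → Bool
isOne 0F = false
isOne 1F = true
isZero 0F = true
isZero 1F = false

-- I d a α b as a sequence of d pairs of positions: α_i puts exactly one of 2i, 2i + 1
-- into I, that is, the last position of the i-th pair or the first one of the next.
rows : Fin 2 → Vec (Fin 2) k → Fin 2 → Subset (suc k ℕ.* 2)
rows a []      b = isOne a ∷ isZero b ∷ []
rows a (c ∷ α) b = isOne a ∷ isZero c ∷ rows c α b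

-- Position 0 lies outside [2d], but it matters here: dropping the first pair shifts all positions
-- by 2, so that the second entry of that pair asks for position 0 of the remaining list.
mem-0-listI : ∀ k a (α : Fin k → Fin 2) b → mem 0 (listI k (toℕ a) α b) ≡ isZero a
mem-0-listI zero    0F α b = refl
mem-0-listI zero    1F α b = refl
mem-0-listI (suc k) a  α b = trans (cong (mem 0) (listI-suc k (toℕ a) α b)) (go a)
  where
  xs = listI k (toℕ (α zero)) (α ∘ suc) b
  go : ∀ a → mem 0 (toℕ a List.∷ List.map (2 ℕ.+_) xs) ≡ isZero a
  go 0F = refl
  go 1F = mem0 xs

I≡rows : ∀ k a α b → I (suc k) a α b ≡ rows a α b
I≡rows zero 0F [] 0F = refl
I≡rows zero 0F [] 1F = refl
I≡rows zero 1F [] 0F = refl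
I≡rows zero 1F [] 1F = refl
I≡rows (suc k) a (c ∷ α) b = trans
  (Vec.tabulate-cong λ j → cong (mem (suc (toℕ j))) (listI-suc k (toℕ a) (lookup (c ∷ α)) b))
  (cong₂ _∷_ (mem-1 a) (cong₂ _∷_ (trans (mem-2+ a 0) (mem-0-listI k c (lookup α) b))
    (trans (Vec.tabulate-cong λ j → mem-2+ a (suc (toℕ j))) (I≡rows k c α b))))
  where
  xs = listI k (toℕ c) (lookup α) b
  mem-1 : ∀ a → mem 1 (toℕ a List.∷ List.map (2 ℕ.+_) xs) ≡ isOne a
  mem-1 0F = mem1 xs
  mem-1 1F = refl
  mem-2+ : ∀ a p → mem (2 ℕ.+ p) (toℕ a List.∷ List.map (2 ℕ.+_) xs) ≡ mem p xs
  mem-2+ 0F p = mem+2 p xs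
  mem-2+ 1F p = mem+2 p xs

-- With a = 0 and b = 1 both ends of the list for I, namely 0 and 2d + 1, fall outside [2d], which
-- leaves d - 1 rows for every tag. The constant tag makes all pairs but the last alike.
∣rows01∣ : ∀ k → ∣ rows 0F (Vec.replicate k 0F) 1F ∣ ≡ k
∣rows01∣ zero    = refl
∣rows01∣ (suc k) = cong suc (∣rows01∣ k)

∁-rows10 : ∀ k → ∁ (rows 1F (Vec.replicate k 1F) 0F) ≡ rows 0F (Vec.replicate k 0F) 1F
∁-rows10 zero    = refl
∁-rows10 (suc k) = cong (λ S → outside ∷ inside ∷ S) (∁-rows10 k)

-- The analogues of take and drop for sequences of pairs, for which the length
-- (e + f) * 2 need not be rewritten.
takePairs : ∀ e {f} → Vec X ((e ℕ.+ f) ℕ.* 2) → Vec X (e ℕ.* 2)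
takePairs zero    w           = []
takePairs (suc e) (x ∷ y ∷ w) = x ∷ y ∷ takePairs e w

dropPairs : ∀ e {f} → Vec X ((e ℕ.+ f) ℕ.* 2) → Vec X (f ℕ.* 2)
dropPairs zero    w           = w
dropPairs (suc e) (x ∷ y ∷ w) = dropPairs e w

takePairs-zipWith : ∀ e {f} (h : X → Y → Z) (u : Vec X ((e ℕ.+ f) ℕ.* 2)) v →
  takePairs e {f} (Vec.zipWith h u v) ≡ Vec.zipWith h (takePairs e {f} u) (takePairs e {f} v)
takePairs-zipWith zero    h u           v             = refl
takePairs-zipWith (suc e) h (_ ∷ _ ∷ u) (_ ∷ _ ∷ v) =
  cong (λ w → _ ∷ _ ∷ w) (takePairs-zipWith e h u v)

dropPairs-zipWith : ∀ e {f} (h : X → Y → Z) (u : Vec X ((e ℕ.+ f) ℕ.* 2)) v →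
  dropPairs e {f} (Vec.zipWith h u v) ≡ Vec.zipWith h (dropPairs e {f} u) (dropPairs e {f} v)
dropPairs-zipWith zero    h u           v             = refl
dropPairs-zipWith (suc e) h (_ ∷ _ ∷ u) (_ ∷ _ ∷ v) = dropPairs-zipWith e h u v

takePairs-map : ∀ e {f} (h : X → Y) (u : Vec X ((e ℕ.+ f) ℕ.* 2)) →
  takePairs e {f} (Vec.map h u) ≡ Vec.map h (takePairs e {f} u)
takePairs-map zero    h u           = refl
takePairs-map (suc e) h (_ ∷ _ ∷ u) = cong (λ w → _ ∷ _ ∷ w) (takePairs-map e h u)

dropPairs-map : ∀ e {f} (h : X → Y) (u : Vec X ((e ℕ.+ f) ℕ.* 2)) →
  dropPairs e {f} (Vec.map h u) ≡ Vec.map h (dropPairs e {f} u)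
dropPairs-map zero    h u           = refl
dropPairs-map (suc e) h (_ ∷ _ ∷ u) = dropPairs-map e h u

-- Positions 2e and 2e + 1 lie on the same sides whether the bit between them ends
-- the first pattern and starts the second one, or is interior to the joint pattern.
takePairs-rows : ∀ a {e f} (α : Vec (Fin 2) e) c (β : Vec (Fin 2) f) b →
  takePairs (suc e) {suc f} (rows a (α Vec.++ c ∷ β) b) ≡ rows a α c
takePairs-rows a []       c β b = refl
takePairs-rows a (a′ ∷ α) c β b = cong (λ S → _ ∷ _ ∷ S) (takePairs-rows a′ α c β b)

dropPairs-rows : ∀ a {e f} (α : Vec (Fin 2) e) c (β : Vec (Fin 2) f) b →
  dropPairs (suc e) {suc f} (rows a (α Vec.++ c ∷ β) b) ≡ rows c β b
dropPairs-rows a []       c β b = refl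
dropPairs-rows a (a′ ∷ α) c β b = dropPairs-rows a′ α c β b

pair : ∀ d → Vec (Fin n) (d ℕ.* 2) → Vec (Fin (n ℕ.* n)) d
pair zero    []          = []
pair (suc d) (x ∷ y ∷ w) = combine x y ∷ pair d w

-- Spelled as in the body of `flat`, so that `flat` evaluated at `pair d w` is by definition the
-- tensor at `unpair (pair d w)`.
unpair : ∀ {d} → Vec (Fin (n ℕ.* n)) d → Vec (Fin n) (d ℕ.* 2)
unpair {n = n} v = Vec.concat (Vec.map (λ i → quotient n i ∷ remainder {n} n i ∷ []) v)

unpair-pair : ∀ d (w : Vec (Fin n) (d ℕ.* 2)) → unpair (pair d w) ≡ w
unpair-pair zero    []          = refl
unpair-pair (suc d) (x ∷ y ∷ w) = cong₂ _∷_ (cong proj₁ eq) (cong₂ _∷_ (cong proj₂ eq) (unpair-pair d w))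
  where eq = Fin.remQuot-combine x y

take-pair : ∀ e f (w : Vec (Fin n) ((e ℕ.+ f) ℕ.* 2)) → Vec.take e (pair (e ℕ.+ f) w) ≡ pair e (takePairs e {f} w)
take-pair zero    f w           = refl
take-pair (suc e) f (x ∷ y ∷ w) = cong (_ ∷_) (take-pair e f w)

drop-pair : ∀ e f (w : Vec (Fin n) ((e ℕ.+ f) ℕ.* 2)) → Vec.drop e (pair (e ℕ.+ f) w) ≡ pair f (dropPairs e {f} w)
drop-pair zero    f w           = refl
drop-pair (suc e) f (x ∷ y ∷ w) = drop-pair e f w

-- Row and column coordinates as masked tuples of full length

module Masks {X : Set} (o : X) where

  -- Overwrites the coordinates outside S by o, so that the functions of the
  -- S-coordinates are those of the form f ∘ mask S.
  mask : Subset m → Vec X m → Vec X m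
  mask = Vec.zipWith (λ s x → if s then x else o)

  mask-merge : ∀ (S : Subset m) u v → mask S (merge S u v) ≡ merge S u (Vec.replicate _ o)
  mask-merge []            []      []      = refl
  mask-merge (inside  ∷ S) (x ∷ u) v       = cong (x ∷_) (mask-merge S u v)
  mask-merge (outside ∷ S) u       (x ∷ v) = cong (o ∷_) (mask-merge S u v)

  mask-∁-merge : ∀ (S : Subset m) u v → mask (∁ S) (merge S u v) ≡ merge S (Vec.replicate _ o) v
  mask-∁-merge []            []      []      = refl
  mask-∁-merge (inside  ∷ S) (x ∷ u) v       = cong (o ∷_) (mask-∁-merge S u v)
  mask-∁-merge (outside ∷ S) u       (x ∷ v) = cong (x ∷_) (mask-∁-merge S u v)

  -- The counterpart of `merge` for masked tuples: all lengths stay m, whereas those in `merge`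
  -- depend on S.
  overlay : Subset m → Vec X m → Vec X m → Vec X m
  overlay []            []      []      = []
  overlay (inside  ∷ S) (x ∷ u) (y ∷ v) = x ∷ overlay S u v
  overlay (outside ∷ S) (x ∷ u) (y ∷ v) = y ∷ overlay S u v

  overlay-mask : ∀ (S : Subset m) w → overlay S (mask S w) (mask (∁ S) w) ≡ w
  overlay-mask []            []      = refl
  overlay-mask (inside  ∷ S) (x ∷ w) = cong (x ∷_) (overlay-mask S w)
  overlay-mask (outside ∷ S) (x ∷ w) = cong (x ∷_) (overlay-mask S w)

  overlay-mask-∁ : ∀ (S : Subset m) w → overlay (∁ S) (mask (∁ S) w) (mask S w) ≡ w
  overlay-mask-∁ []            []      = refl
  overlay-mask-∁ (inside  ∷ S) (x ∷ w) = cong (x ∷_) (overlay-mask-∁ S w)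
  overlay-mask-∁ (outside ∷ S) (x ∷ w) = cong (x ∷_) (overlay-mask-∁ S w)

  module _ (e f : ℕ) (S : Subset ((e ℕ.+ f) ℕ.* 2)) (w : Vec X ((e ℕ.+ f) ℕ.* 2)) where
    takePairs-mask : takePairs e {f} (mask S w) ≡ mask (takePairs e {f} S) (takePairs e {f} w)
    takePairs-mask = takePairs-zipWith e {f} _ S w

    dropPairs-mask : dropPairs e {f} (mask S w) ≡ mask (dropPairs e {f} S) (dropPairs e {f} w)
    dropPairs-mask = dropPairs-zipWith e {f} _ S w

-- Natural and rational inequalities

n≤2^⌈log₂n⌉ : ∀ n → n ℕ.≤ 2 ℕ.^ ⌈log₂ n ⌉
n≤2^⌈log₂n⌉ = <-rec _ go
  where
  go : ∀ n → (∀ {m} → m ℕ.< n → m ℕ.≤ 2 ℕ.^ ⌈log₂ m ⌉) → n ℕ.≤ 2 ℕ.^ ⌈log₂ n ⌉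
  go zero          rec = z≤n
  go (suc zero)    rec = ℕ.m^n>0 2 ⌈log₂ 1 ⌉
  go n@(suc (suc m)) rec = begin
    n                                  ≡⟨ ℕ.⌊n/2⌋+⌈n/2⌉≡n n ⟨
    ℕ.⌊ n /2⌋ ℕ.+ ℕ.⌈ n /2⌉            ≤⟨ ℕ.+-monoˡ-≤ _ (ℕ.⌊n/2⌋≤⌈n/2⌉ n) ⟩
    ℕ.⌈ n /2⌉ ℕ.+ ℕ.⌈ n /2⌉            ≡⟨ cong (ℕ.⌈ n /2⌉ ℕ.+_) (ℕ.+-identityʳ _) ⟨
    2 ℕ.* ℕ.⌈ n /2⌉                    ≤⟨ ℕ.*-monoʳ-≤ 2 (rec (ℕ.⌈n/2⌉<n m)) ⟩
    2 ℕ.^ suc ⌈log₂ ℕ.⌈ n /2⌉ ⌉        ≡⟨ cong (λ k → 2 ℕ.^ suc k) (⌈log₂⌈n/2⌉⌉≡⌈log₂n⌉∸1 n) ⟩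
    -- The truncated subtraction loses nothing, since n ≥ 2 gives ⌈log₂ n⌉ ≥ 1.
    2 ℕ.^ suc (⌈log₂ n ⌉ ℕ.∸ 1)        ≡⟨ cong (2 ℕ.^_) (ℕ.m+[n∸m]≡n (⌈log₂⌉-mono-≤ {2} {n} (s≤s (s≤s z≤n)))) ⟩
    2 ℕ.^ ⌈log₂ n ⌉                    ∎
    where open ℕ.≤-Reasoning

^-cancelʳ-≤ : ∀ m {p q} → 1 ℕ.< m → m ℕ.^ p ℕ.≤ m ℕ.^ q → p ℕ.≤ q
^-cancelʳ-≤ m 1<m le = ℕ.≮⇒≥ λ q<p → ℕ.≤⇒≯ le (ℕ.^-monoʳ-< m 1<m q<p)

toℚᵘ-/ : ∀ i d .{{_ : NonZero d}} → ℚ.toℚᵘ (i / d) ℚᵘ.≃ (i ℚᵘ./ d)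
toℚᵘ-/ i (suc d) = ℚ.toℚᵘ-fromℚᵘ (ℚᵘ.mkℚᵘ i d)

/-distribʳ-+ : ∀ a b d .{{_ : NonZero d}} → (+ (a ℕ.+ b)) / d ≡ (+ a) / d ℚ.+ (+ b) / d
/-distribʳ-+ a b d@(suc _) = ℚ.toℚᵘ-injective (begin
  ℚ.toℚᵘ (+ (a ℕ.+ b) / d)                ≈⟨ toℚᵘ-/ (+ (a ℕ.+ b)) d ⟩
  + (a ℕ.+ b) ℚᵘ./ d                      ≈⟨ ℚᵘ.*≡* cross ⟩
  (+ a ℚᵘ./ d) ℚᵘ.+ (+ b ℚᵘ./ d)           ≈⟨ ℚᵘ.+-cong (toℚᵘ-/ (+ a) d) (toℚᵘ-/ (+ b) d) ⟨
  ℚ.toℚᵘ (+ a / d) ℚᵘ.+ ℚ.toℚᵘ (+ b / d)   ≈⟨ ℚ.toℚᵘ-homo-+ (+ a / d) (+ b / d) ⟨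
  ℚ.toℚᵘ (+ a / d ℚ.+ + b / d)             ∎)
  where
  open ≈-Reasoning ℚᵘ.≃-setoid
  cross : + (a ℕ.+ b) ℤ.* (+ d ℤ.* + d) ≡ (+ a ℤ.* + d ℤ.+ + b ℤ.* + d) ℤ.* + d
  cross = trans (sym (ℤ.*-assoc (+ (a ℕ.+ b)) (+ d) (+ d))) (cong (ℤ._* + d) (ℤ.*-distribʳ-+ (+ d) (+ a) (+ b)))

0≤/ : ∀ a d .{{_ : NonZero d}} → 0ℚ ℚ.≤ (+ a) / d
0≤/ a d = ℚ.nonNegative⁻¹ (+ a / d) {{ℚ.normalize-nonNeg a d}}

*-/-≤ : ∀ k a l d .{{_ : NonZero d}} → k ℕ.* a ℕ.≤ l ℕ.* d → (+ k / 1) ℚ.* (+ a / d) ℚ.≤ + l / 1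
*-/-≤ k a l d@(suc _) le = ℚ.toℚᵘ-cancel-≤ (begin
  ℚ.toℚᵘ ((+ k / 1) ℚ.* (+ a / d))         ≃⟨ ℚ.toℚᵘ-homo-* (+ k / 1) (+ a / d) ⟩
  ℚ.toℚᵘ (+ k / 1) ℚᵘ.* ℚ.toℚᵘ (+ a / d)   ≃⟨ ℚᵘ.*-cong (toℚᵘ-/ (+ k) 1) (toℚᵘ-/ (+ a) d) ⟩
  (+ k ℚᵘ./ 1) ℚᵘ.* (+ a ℚᵘ./ d)           ≤⟨ ℚᵘ.*≤* (subst₂ ℤ._≤_ lhs rhs (ℤ.+≤+ le)) ⟩
  + l ℚᵘ./ 1                               ≃⟨ toℚᵘ-/ (+ l) 1 ⟨
  ℚ.toℚᵘ (+ l / 1)                         ∎)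
  where
  open ℚᵘ.≤-Reasoning
  lhs : + (k ℕ.* a) ≡ + k ℤ.* + a ℤ.* + 1
  lhs = trans (ℤ.pos-* k a) (sym (ℤ.*-identityʳ _))
  rhs : + (l ℕ.* d) ≡ + l ℤ.* (+ 1 ℤ.* + d)
  rhs = trans (ℤ.pos-* l d) (cong (+ l ℤ.*_) (sym (ℤ.*-identityˡ (+ d))))

0≤* : ∀ {x y} → 0ℚ ℚ.≤ x → 0ℚ ℚ.≤ y → 0ℚ ℚ.≤ x ℚ.* y
0≤* {x} {y} 0≤x 0≤y = ℚ.≤-trans (ℚ.≤-reflexive (sym (ℚ.*-zeroʳ x))) (ℚ.*-monoˡ-≤-nonNeg x {{ℚ.nonNegative 0≤x}} 0≤y)

0≤^ : ∀ q {x} → 0ℚ ℚ.≤ x → 0ℚ ℚ.≤ x ^ q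
0≤^ zero    0≤x = ℚ.<⇒≤ (ℚ.positive⁻¹ 1ℚ)
0≤^ (suc q) 0≤x = 0≤* 0≤x (0≤^ q 0≤x)

^-monoˡ-≤ : ∀ q {x y} → 0ℚ ℚ.≤ x → x ℚ.≤ y → x ^ q ℚ.≤ y ^ q
^-monoˡ-≤ zero    0≤x x≤y = ℚ.≤-refl
^-monoˡ-≤ (suc q) {x} {y} 0≤x x≤y = ℚ.≤-trans
  (ℚ.*-monoˡ-≤-nonNeg x {{ℚ.nonNegative 0≤x}} (^-monoˡ-≤ q 0≤x x≤y))
  (ℚ.*-monoʳ-≤-nonNeg (y ^ q) {{ℚ.nonNegative (0≤^ q (ℚ.≤-trans 0≤x x≤y))}} x≤y)

/1-mono : ∀ {a b} → a ℕ.≤ b → + a / 1 ℚ.≤ + b / 1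
/1-mono {a} {b} a≤b = subst (ℚ._≤ + b / 1) (ℚ.*-identityˡ _)
  (*-/-≤ 1 a b 1 (subst₂ ℕ._≤_ (sym (ℕ.*-identityˡ a)) (sym (ℕ.*-identityʳ b)) a≤b))

/1-* : ∀ a b → + (a ℕ.* b) / 1 ≡ (+ a / 1) ℚ.* (+ b / 1)
/1-* a b = ℚ.toℚᵘ-injective (ℚᵘ.≃-trans (toℚᵘ-/ (+ (a ℕ.* b)) 1) (ℚᵘ.≃-trans
    (ℚᵘ.*≡* (cong (ℤ._* + 1) (ℤ.pos-* a b)))
    (ℚᵘ.≃-sym (ℚᵘ.≃-trans (ℚ.toℚᵘ-homo-* (+ a / 1) (+ b / 1)) (ℚᵘ.*-cong (toℚᵘ-/ (+ a) 1) (toℚᵘ-/ (+ b) 1))))))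

/1-^ : ∀ a q → + (a ℕ.^ q) / 1 ≡ (+ a / 1) ^ q
/1-^ a zero    = refl
/1-^ a (suc q) = trans (/1-* a (a ℕ.^ q)) (cong ((+ a / 1) ℚ.*_) (/1-^ a q))

-- With K = ⌈log₂ d⌉, the bounds 2^p ≤ d^q ≤ 2^(Kq) force p ≤ Kq, so n^p x^q ≤ (n^K x)^q ≤ y^q.
-- Nonnegativity of x makes the powers monotone.
^⌈log₂⌉⇒^log₂ : ∀ n d .{{_ : NonZero n}} {x y} → 0ℚ ℚ.≤ x →
  (+ (n ℕ.^ ⌈log₂ d ⌉) / 1) ℚ.* x ℚ.≤ y → n ^log₂ d · x ≤ y
^⌈log₂⌉⇒^log₂ n d {x} {y} 0≤x Nx≤y p q 2^p≤d^q = begin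
  (+ (n ℕ.^ p) / 1) ℚ.* x ^ q           ≤⟨ ℚ.*-monoʳ-≤-nonNeg (x ^ q) {{ℚ.nonNegative (0≤^ q 0≤x)}} (/1-mono (ℕ.^-monoʳ-≤ n p≤Kq)) ⟩
  (+ (n ℕ.^ (K ℕ.* q)) / 1) ℚ.* x ^ q   ≡⟨ cong (λ z → (+ z / 1) ℚ.* x ^ q) (ℕ.^-*-assoc n K q) ⟨
  (+ (N ℕ.^ q) / 1) ℚ.* x ^ q           ≡⟨ cong (ℚ._* x ^ q) (/1-^ N q) ⟩
  (+ N / 1) ^ q ℚ.* x ^ q               ≡⟨ ^-distrib-* (+ N / 1) x q ⟨
  ((+ N / 1) ℚ.* x) ^ q                 ≤⟨ ^-monoˡ-≤ q (0≤* (0≤/ N 1) 0≤x) Nx≤y ⟩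
  y ^ q                                 ∎
  where
  open ℚ.≤-Reasoning
  K = ⌈log₂ d ⌉
  N = n ℕ.^ K
  p≤Kq : p ℕ.≤ K ℕ.* q
  p≤Kq = ^-cancelʳ-≤ 2 (s≤s (s≤s z≤n)) (ℕ.≤-trans 2^p≤d^q
    (subst (d ℕ.^ q ℕ.≤_) (ℕ.^-*-assoc 2 K q) (ℕ.^-monoˡ-≤ q (n≤2^⌈log₂n⌉ d))))

sumBits-/ : ∀ d .{{_ : NonZero d}} (r : Vec (Fin 2) k → ℕ) {y : Vec (Fin 2) k → ℚ} →
  (∀ α → y α ≡ + r α / d) → sumBits ℚ._+_ y ≡ + sumBits ℕ._+_ r / d
sumBits-/ {k = zero}  d r y≡ = y≡ []
sumBits-/ {k = suc k} d r y≡ = trans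
  (cong₂ ℚ._+_ (sumBits-/ d (r ∘ (0F ∷_)) (y≡ ∘ (0F ∷_))) (sumBits-/ d (r ∘ (1F ∷_)) (y≡ ∘ (1F ∷_))))
  (sym (/-distribʳ-+ (sumBits ℕ._+_ (r ∘ (0F ∷_))) (sumBits ℕ._+_ (r ∘ (1F ∷_))) d))

sumBits-mono-≤ : {r s : Vec (Fin 2) k → ℕ} → (∀ α → r α ℕ.≤ s α) → sumBits ℕ._+_ r ℕ.≤ sumBits ℕ._+_ s
sumBits-mono-≤ {k = zero}  r≤s = r≤s []
sumBits-mono-≤ {k = suc k} r≤s =
  ℕ.+-mono-≤ (sumBits-mono-≤ (r≤s ∘ (0F ∷_))) (sumBits-mono-≤ (r≤s ∘ (1F ∷_)))

-- Double negation commutes with a finite conjunction. This allows assuming that all 2^k ranks exist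
-- at once.
¬¬-∀bits : {P : Vec (Fin 2) k → Set a} → (∀ α → ¬ ¬ P α) → ¬ ¬ (∀ α → P α)
¬¬-∀bits {k = zero}  p ¬all = p [] λ q → ¬all λ { [] → q }
¬¬-∀bits {k = suc k} p ¬all =
  ¬¬-∀bits (p ∘ (0F ∷_)) λ q₀ → ¬¬-∀bits (p ∘ (1F ∷_)) λ q₁ →
    ¬all λ { (0F ∷ α) → q₀ α ; (1F ∷ α) → q₁ α }

-- Search downwards from the bound. Each step has to decide `P`, hence the double negation; applied
-- to independent columns it supplies ranks over a field without decidable equality.
¬¬-maximum : {P : ℕ → Set a} (b : ℕ) → P 0 → (∀ r → P r → r ℕ.≤ b) → ¬ ¬ (∃[ r ] IsMaximum ℕ._≤_ P r)
¬¬-maximum zero    p₀ bound ¬max = ¬max (0 , p₀ , bound)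
¬¬-maximum (suc b) p₀ bound ¬max = ¬¬-excluded-middle λ where
  (yes p) → ¬max (suc b , p , bound)
  (no ¬p) → ¬¬-maximum b p₀ (λ r p → ℕ.≤-pred (ℕ.≤∧≢⇒< (bound r p) λ { refl → ¬p p })) ¬max

-- Sums over lists

_≟ᵇ_ : ∀ (α β : Vec (Fin 2) k) → Dec (α ≡ β)
_≟ᵇ_ = Vec.≡-dec Fin._≟_

module ListSum {c ℓ} (M : CommutativeMonoid c ℓ) where

  open CommutativeMonoid M renaming (Carrier to 𝕂; refl to ≈-refl; sym to ≈-sym; trans to ≈-trans)
  open CSemigroup commutativeSemigroup using (x∙yz≈y∙xz)

  ∑ : List A → (A → 𝕂) → 𝕂
  ∑ []       h = ε
  ∑ (x ∷ xs) h = h x ∙ ∑ xs h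

  ∑-cong : ∀ (xs : List A) {h h′} → (∀ x → h x ≈ h′ x) → ∑ xs h ≈ ∑ xs h′
  ∑-cong []       eq = ≈-refl
  ∑-cong (x ∷ xs) eq = ∙-cong (eq x) (∑-cong xs eq)

  ∑-cong-All : ∀ {xs : List A} {h h′} → All (λ x → h x ≈ h′ x) xs → ∑ xs h ≈ ∑ xs h′
  ∑-cong-All []         = ≈-refl
  ∑-cong-All (eq ∷ eqs) = ∙-cong eq (∑-cong-All eqs)

  ∑-++ : ∀ (xs ys : List A) h → ∑ (xs ++ ys) h ≈ ∑ xs h ∙ ∑ ys h
  ∑-++ []       ys h = ≈-sym (identityˡ _)
  ∑-++ (x ∷ xs) ys h = ≈-trans (∙-congˡ (∑-++ xs ys h)) (≈-sym (assoc _ _ _))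

  ∑-map : ∀ (f : A → B) xs h → ∑ (List.map f xs) h ≡ ∑ xs (h ∘ f)
  ∑-map f []       h = refl
  ∑-map f (x ∷ xs) h = cong (h (f x) ∙_) (∑-map f xs h)

  ∑-cartesianProductWith : ∀ {D : Set a} (_⊗_ : A → B → D) xs ys h →
    ∑ (cartesianProductWith _⊗_ xs ys) h ≈ ∑ xs (λ x → ∑ ys (λ y → h (x ⊗ y)))
  ∑-cartesianProductWith _⊗_ []       ys h = ≈-refl
  ∑-cartesianProductWith _⊗_ (x ∷ xs) ys h = ≈-trans (∑-++ (List.map (x ⊗_) ys) _ h)
    (∙-cong (reflexive (∑-map (x ⊗_) ys h)) (∑-cartesianProductWith _⊗_ xs ys h))

  sumBits-cong : {f g : Vec (Fin 2) k → 𝕂} → (∀ α → f α ≈ g α) → sumBits _∙_ f ≈ sumBits _∙_ g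
  sumBits-cong {k = zero}  eq = eq []
  sumBits-cong {k = suc k} eq = ∙-cong (sumBits-cong (eq ∘ (0F ∷_))) (sumBits-cong (eq ∘ (1F ∷_)))

  sumBits-ε : ∀ k → sumBits {k = k} _∙_ (λ _ → ε) ≈ ε
  sumBits-ε zero    = ≈-refl
  sumBits-ε (suc k) = ≈-trans (∙-cong (sumBits-ε k) (sumBits-ε k)) (identityˡ ε)

  -- Used when one element joins a list sorted by tags: only the summand at its own tag t changes.
  sumBits-update : ∀ (t : Vec (Fin 2) k) {f g v} → f t ≈ v ∙ g t → (∀ α → ¬ t ≡ α → f α ≈ g α) →
    sumBits _∙_ f ≈ v ∙ sumBits _∙_ g
  sumBits-update []       ft eq = ft
  sumBits-update (0F ∷ t) ft eq = ≈-trans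
    (∙-cong (sumBits-update t ft (λ α t≢α → eq (0F ∷ α) (t≢α ∘ Vec.∷-injectiveʳ)))
            (sumBits-cong (λ α → eq (1F ∷ α) λ ())))
    (assoc _ _ _)
  sumBits-update (1F ∷ t) ft eq = ≈-trans
    (∙-cong (sumBits-cong (λ α → eq (0F ∷ α) λ ()))
            (sumBits-update t ft (λ α t≢α → eq (1F ∷ α) (t≢α ∘ Vec.∷-injectiveʳ))))
    (x∙yz≈y∙xz _ _ _)

  -- Each element passes the filter of exactly one α, that of its own tag.
  ∑-byTag : ∀ (tag : A → Vec (Fin 2) k) xs h →
    sumBits _∙_ (λ α → ∑ (filter (λ x → tag x ≟ᵇ α) xs) h) ≈ ∑ xs h
  ∑-byTag {k = k} tag [] h = sumBits-ε k
  ∑-byTag tag (x ∷ xs) h = ≈-trans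
    (sumBits-update (tag x)
      (reflexive (cong (λ ys → ∑ ys h) (List.filter-accept (λ y → tag y ≟ᵇ tag x) refl)))
      (λ α t≢α → reflexive (cong (λ ys → ∑ ys h) (List.filter-reject (λ y → tag y ≟ᵇ α) t≢α))))
    (∙-congˡ (∑-byTag tag xs h))

-- The regrouping `∑-byTag` in the monoid of naturals under addition, every element having weight 1.
length-byTag : ∀ {a} {A : Set a} {k} (tag : A → Vec (Fin 2) k) xs →
  sumBits ℕ._+_ (λ α → length (filter (λ x → tag x ≟ᵇ α) xs)) ≡ length xs
length-byTag {k = k} tag xs = trans
  (sumBits-cong {k = k} λ α → sym (∑-1 (filter (λ x → tag x ≟ᵇ α) xs)))
  (trans (∑-byTag tag xs (λ _ → 1)) (∑-1 xs))
  where
  open ListSum ℕ.+-0-commutativeMonoid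
  ∑-1 : ∀ ys → ∑ ys (λ _ → 1) ≡ length ys
  ∑-1 []       = refl
  ∑-1 (y ∷ ys) = cong suc (∑-1 ys)

length-cartesianProductWith : ∀ {a b d} {A : Set a} {B : Set b} {D : Set d} (f : A → B → D) xs ys →
  length (cartesianProductWith f xs ys) ≡ length xs ℕ.* length ys
length-cartesianProductWith f []       ys = refl
length-cartesianProductWith f (x ∷ xs) ys = trans (List.length-++ (List.map (f x) ys))
  (cong₂ ℕ._+_ (List.length-map (f x) ys) (length-cartesianProductWith f xs ys))

scaled-+ : ∀ N r s x y D → N ℕ.* r ℕ.≤ x ℕ.* D → N ℕ.* s ℕ.≤ y ℕ.* D → N ℕ.* (r ℕ.+ s) ℕ.≤ (x ℕ.+ y) ℕ.* D
scaled-+ N r s x y D r≤ s≤ = begin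
  N ℕ.* (r ℕ.+ s)           ≡⟨ ℕ.*-distribˡ-+ N r s ⟩
  N ℕ.* r ℕ.+ N ℕ.* s       ≤⟨ ℕ.+-mono-≤ r≤ s≤ ⟩
  x ℕ.* D ℕ.+ y ℕ.* D       ≡⟨ ℕ.*-distribʳ-+ D x y ⟨
  (x ℕ.+ y) ℕ.* D           ∎
  where open ℕ.≤-Reasoning

-- The second factor contributes n^f terms, while its order contributes n^(f+1) on the right. The
-- spare n raises the exponent K by one.
scaled-* : ∀ n K r L e f → n ℕ.^ K ℕ.* r ℕ.≤ L ℕ.* n ℕ.^ suc e →
  n ℕ.^ suc K ℕ.* (r ℕ.* n ℕ.^ f) ℕ.≤ L ℕ.* n ℕ.^ (suc e ℕ.+ suc f)
scaled-* n K r L e f r≤ = begin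
  n ℕ.^ suc K ℕ.* (r ℕ.* n ℕ.^ f)       ≡⟨ solve 4 (λ n N r M → n :* N :* (r :* M) := N :* r :* (n :* M)) refl n (n ℕ.^ K) r (n ℕ.^ f) ⟩
  n ℕ.^ K ℕ.* r ℕ.* n ℕ.^ suc f         ≤⟨ ℕ.*-monoˡ-≤ (n ℕ.^ suc f) r≤ ⟩
  L ℕ.* n ℕ.^ suc e ℕ.* n ℕ.^ suc f     ≡⟨ ℕ.*-assoc L (n ℕ.^ suc e) (n ℕ.^ suc f) ⟩
  L ℕ.* (n ℕ.^ suc e ℕ.* n ℕ.^ suc f)   ≡⟨ cong (L ℕ.*_) (ℕ.^-distribˡ-+-* n (suc e) (suc f)) ⟨
  L ℕ.* n ℕ.^ (suc e ℕ.+ suc f)         ∎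
  where open ℕ.≤-Reasoning

-- Tensors over a field

module _ {c ℓ₁ ℓ₂} (F : HeytingField c ℓ₁ ℓ₂) where

  open HeytingField F using (_#_; tight; #⇒invertible; heytingCommutativeRing)
  open CommutativeRing (HeytingCommutativeRing.commutativeRing heytingCommutativeRing)
    hiding (zero) renaming (Carrier to 𝕂; refl to ≈-refl; sym to ≈-sym; trans to ≈-trans)
  open HeytingProperties heytingCommutativeRing using (1#0; x-0≈x)
  open RingProperties ring using (-‿distribˡ-*; -‿distribʳ-*)
  open SemiringSum semiring using (sum; sum-cong-≋; sum-replicate-zero; sum-remove; ∑-distrib-+; *-distribˡ-sum; *-distribʳ-sum)
  open CSemigroup *-commutativeSemigroup using (interchange; x∙yz≈y∙xz)
  open ListSum +-commutativeMonoid
  open ≈-Reasoning setoid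
  open MonoidSum ℕ.+-0-monoid using () renaming (sum to sumℕ)

  -- Linear systems and an upper bound on the rank

  sum-zero : ∀ {s} {t : Fin s → 𝕂} → (∀ j → t j ≈ 0#) → sum t ≈ 0#
  sum-zero {s} eq = ≈-trans (sum-cong-≋ eq) (sum-replicate-zero s)

  -- Gaussian elimination: a pivot in the first equation removes one unknown.
  homogeneous-solution : ∀ (xs : List A) {s} (G : A → Fin s → 𝕂) → length xs ℕ.< s →
    ¬ ¬ (Σ[ t ∈ (Fin s → 𝕂) ] (Σ[ j ∈ Fin s ] t j # 0#) × All (λ x → sum (λ j → t j * G x j) ≈ 0#) xs)
  homogeneous-solution []       {suc s} G lt ¬sol = ¬sol ((λ _ → 1#) , (zero , 1#0) , [])
  homogeneous-solution {A = A} (x ∷ xs) {suc s} G (s≤s lt) ¬sol = ¬¬-excluded-middle λ where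
      -- Without a pivot, tightness makes every coefficient of the first equation zero, so it holds
      -- for any solution of the others.
      (no ¬pivot) → homogeneous-solution xs G (ℕ.m<n⇒m<1+n lt) λ (t , t#0 , sols) →
        ¬sol (t , t#0 , sum-zero (λ j → ≈-trans (*-congˡ (proj₁ (tight _ _) (¬pivot ∘ (j ,_)))) (zeroʳ (t j))) ∷ sols)
      (yes (p , Gxp#0)) → eliminate p (#⇒invertible Gxp#0)
    where
    eliminate : ∀ p → (∃[ g ] (g * (G x p - 0#) ≈ 1#) × ((G x p - 0#) * g ≈ 1#)) → _
    eliminate p (g , gG≈1 , _) = homogeneous-solution xs G′ lt λ (t , (j , tj#0) , sols) →
      ¬sol (extend t , (punchIn p j , subst (_# 0#) (sym (insertAt-punchIn t p _ j)) tj#0)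
        , ≈-trans (extend-sum t x) (sum-zero (λ i → ≈-trans (*-congˡ (G′x≈0 i)) (zeroʳ (t i))))
        ∷ All.map (λ {y} → ≈-trans (extend-sum t y)) sols)
      where
      -- As `g` inverts the pivot, subtracting `q i` times the pivot column from each other column
      -- clears the first equation. The value that `extend` gives to the pivot unknown undoes this
      -- column operation.
      q : Fin s → 𝕂
      q i = G x (punchIn p i) * g
      G′ : A → Fin s → 𝕂
      G′ y i = G y (punchIn p i) - q i * G y p
      G′x≈0 : ∀ i → G′ x i ≈ 0#
      G′x≈0 i = begin
        G x (punchIn p i) - G x (punchIn p i) * g * G x p   ≈⟨ +-congˡ (-‿cong (*-assoc _ g _)) ⟩
        G x (punchIn p i) - G x (punchIn p i) * (g * G x p) ≈⟨ +-congˡ (-‿cong (*-congˡ (≈-trans (*-congˡ (≈-sym (x-0≈x _))) gG≈1))) ⟩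
        G x (punchIn p i) - G x (punchIn p i) * 1#          ≈⟨ +-congˡ (-‿cong (*-identityʳ _)) ⟩
        G x (punchIn p i) - G x (punchIn p i)               ≈⟨ -‿inverseʳ _ ⟩
        0#                                                  ∎
      extend : (Fin s → 𝕂) → Fin (suc s) → 𝕂
      extend t = insertAt t p (- sum (λ i → t i * q i))
      extend-sum : ∀ t y → sum (λ j → extend t j * G y j) ≈ sum (λ i → t i * G′ y i)
      extend-sum t y = begin
        sum (λ j → extend t j * G y j)
          ≈⟨ sum-remove {i = p} (λ j → extend t j * G y j) ⟩
        extend t p * G y p + sum (λ i → extend t (punchIn p i) * G y (punchIn p i))
          ≈⟨ +-cong (*-congʳ (reflexive (insertAt-lookup t p _))) (sum-cong-≋ (λ i → *-congʳ (reflexive (insertAt-punchIn t p _ i)))) ⟩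
        - sum (λ i → t i * q i) * G y p + sum (λ i → t i * G y (punchIn p i))
          ≈⟨ +-comm _ _ ⟩
        sum (λ i → t i * G y (punchIn p i)) + - sum (λ i → t i * q i) * G y p
          ≈⟨ +-congˡ (≈-trans (≈-sym (-‿distribˡ-* _ _)) (-‿distribʳ-* _ _)) ⟩
        sum (λ i → t i * G y (punchIn p i)) + sum (λ i → t i * q i) * - G y p
          ≈⟨ +-congˡ (*-distribʳ-sum (- G y p) (λ i → t i * q i)) ⟩
        sum (λ i → t i * G y (punchIn p i)) + sum (λ i → t i * q i * - G y p)
          ≈⟨ ∑-distrib-+ (λ i → t i * G y (punchIn p i)) (λ i → t i * q i * - G y p) ⟨
        sum (λ i → t i * G y (punchIn p i) + t i * q i * - G y p)
          ≈⟨ sum-cong-≋ (λ i → ≈-trans (+-congˡ (*-assoc _ _ _)) (≈-trans (≈-sym (distribˡ (t i) _ _)) (*-congˡ (+-congˡ (≈-sym (-‿distribʳ-* _ _)))))) ⟩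
        sum (λ i → t i * G′ y i) ∎

  -- If r exceeded the number of terms, the equations ∑_j t_j g_x(σ j) = 0, one for each term x,
  -- would have a solution with some t_j apart from 0. It would be a linear dependence of the chosen
  -- columns.
  independent⇒≤ : ∀ {R D : Set} {M : Matrix F R D} (xs : List A) (f : A → R → 𝕂) (g : A → D → 𝕂) →
    (∀ u v → M u v ≈ ∑ xs (λ x → f x u * g x v)) →
    ∀ r (σ : Fin r → D) → IndependentColumns F M r σ → r ℕ.≤ length xs
  independent⇒≤ {M = M} xs f g M≈ r σ indep = ℕ.≮⇒≥ λ lt →
    homogeneous-solution xs (λ x j → g x (σ j)) lt λ (t , (j , tj#0) , sols) →
      proj₂ (tight _ _) (indep t (λ u → ≈-trans (sum-cong-≋ (λ j → *-congˡ {t j} (M≈ u (σ j)))) (vanish t u xs sols)) j) tj#0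
    where
    vanish : ∀ (t : Fin r → 𝕂) u ys → All (λ x → sum (λ j → t j * g x (σ j)) ≈ 0#) ys →
      sum (λ j → t j * ∑ ys (λ x → f x u * g x (σ j))) ≈ 0#
    vanish t u []       []           = sum-zero (λ j → zeroʳ (t j))
    vanish t u (y ∷ ys) (sol ∷ sols) = begin
      sum (λ j → t j * (f y u * g y (σ j) + rest j))
        ≈⟨ sum-cong-≋ (λ j → ≈-trans (distribˡ (t j) _ _) (+-congʳ (x∙yz≈y∙xz _ _ _))) ⟩
      sum (λ j → f y u * (t j * g y (σ j)) + t j * rest j)
        ≈⟨ ∑-distrib-+ (λ j → f y u * (t j * g y (σ j))) (λ j → t j * rest j) ⟩
      sum (λ j → f y u * (t j * g y (σ j))) + sum (λ j → t j * rest j)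
        ≈⟨ +-cong (≈-trans (≈-sym (*-distribˡ-sum (f y u) (λ j → t j * g y (σ j)))) (≈-trans (*-congˡ sol) (zeroʳ _))) (vanish t u ys sols) ⟩
      0# + 0# ≈⟨ +-identityˡ 0# ⟩
      0# ∎
      where rest = λ j → ∑ ys (λ x → f x u * g x (σ j))

  ∑-*ˡ : ∀ c (xs : List A) h → ∑ xs (λ x → c * h x) ≈ c * ∑ xs h
  ∑-*ˡ c []       h = ≈-sym (zeroʳ c)
  ∑-*ˡ c (x ∷ xs) h = ≈-trans (+-congˡ (∑-*ˡ c xs h)) (≈-sym (distribˡ c _ _))

  ∑-*ʳ : ∀ c (xs : List A) h → ∑ xs (λ x → h x * c) ≈ ∑ xs h * c
  ∑-*ʳ c []       h = ≈-sym (zeroˡ c)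
  ∑-*ʳ c (x ∷ xs) h = ≈-trans (+-congˡ (∑-*ʳ c xs h)) (≈-sym (distribʳ c _ _))

  ∑-* : ∀ {B D : Set a} (_⊗_ : A → B → D) (xs : List A) (ys : List B) {f g h} →
    (∀ x y → h (x ⊗ y) ≈ f x * g y) → ∑ (cartesianProductWith _⊗_ xs ys) h ≈ ∑ xs f * ∑ ys g
  ∑-* _⊗_ xs ys {f} {g} {h} eq = begin
    ∑ (cartesianProductWith _⊗_ xs ys) h         ≈⟨ ∑-cartesianProductWith _⊗_ xs ys h ⟩
    ∑ xs (λ x → ∑ ys (λ y → h (x ⊗ y)))          ≈⟨ ∑-cong xs (λ x → ≈-trans (∑-cong ys (eq x)) (∑-*ˡ (f x) ys g)) ⟩
    ∑ xs (λ x → f x * ∑ ys g)                    ≈⟨ ∑-*ʳ (∑ ys g) xs f ⟩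
    ∑ xs f * ∑ ys g                              ∎

  -- Rank-one terms and the splitting of a tensor along one flattening

  δ₁ : Fin m → Fin m → 𝕂
  δ₁ x y = if does (x Fin.≟ y) then 1# else 0#

  ∑-tabulate-zero : ∀ {A : Set} m (g : Fin m → A) {h} → (∀ i → h (g i) ≈ 0#) → ∑ (List.tabulate g) h ≈ 0#
  ∑-tabulate-zero zero    g eq = ≈-refl
  ∑-tabulate-zero (suc m) g eq = ≈-trans (+-cong (eq zero) (∑-tabulate-zero m (g ∘ suc) (eq ∘ suc))) (+-identityˡ 0#)

  ∑-δ₁ : ∀ {A : Set} (x : Fin m) (g : Fin m → A) {h} (v : Fin m → 𝕂) → (∀ i → h (g i) ≈ δ₁ i x * v i) →
    ∑ (List.tabulate g) h ≈ v x
  ∑-δ₁ {m = suc m} zero    g v eq = ≈-trans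
    (+-cong (≈-trans (eq zero) (*-identityˡ _)) (∑-tabulate-zero m (g ∘ suc) (λ i → ≈-trans (eq (suc i)) (zeroˡ _))))
    (+-identityʳ _)
  ∑-δ₁ {m = suc m} (suc x) g v eq = ≈-trans
    (+-cong (≈-trans (eq zero) (zeroˡ _)) (∑-δ₁ x (g ∘ suc) (v ∘ suc) (eq ∘ suc)))
    (+-identityˡ _)

  δ : ∀ {n} → Vec (Fin n) m → Vec (Fin n) m → 𝕂
  δ []      []      = 1#
  δ (x ∷ u) (y ∷ v) = δ₁ x y * δ u v

  module _ {n : ℕ} .{{_ : NonZero n}} (o : Fin n) where

    open Masks o

    δ₁-refl : ∀ (x : Fin n) → δ₁ x x ≡ 1#
    δ₁-refl x with x Fin.≟ x
    ... | yes _  = refl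
    ... | no x≢x = contradiction refl x≢x

    masks : Subset m → List (Vec (Fin n) m)
    masks []            = [] ∷ []
    masks (inside  ∷ S) = cartesianProductWith _∷_ (List.allFin n) (masks S)
    masks (outside ∷ S) = List.map (o ∷_) (masks S)

    length-masks : ∀ (S : Subset m) → length (masks S) ≡ n ℕ.^ ∣ S ∣
    length-masks []            = refl
    length-masks (inside  ∷ S) = trans (length-cartesianProductWith _∷_ (List.allFin n) (masks S))
      (cong₂ ℕ._*_ (List.length-tabulate {n = n} (λ i → i)) (length-masks S))
    length-masks (outside ∷ S) = trans (List.length-map (o ∷_) (masks S)) (length-masks S)

    -- `masks S` lists every tuple that equals o outside S exactly once, so only the summand at u =
    -- `mask S w` survives.
    ∑-δ : ∀ (S : Subset m) w h → ∑ (masks S) (λ u → δ u (mask S w) * h u) ≈ h (mask S w)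
    ∑-δ []            []      h = ≈-trans (+-identityʳ _) (*-identityˡ _)
    ∑-δ (inside  ∷ S) (x ∷ w) h = ≈-trans
      (∑-cartesianProductWith _∷_ (List.allFin n) (masks S) _)
      (∑-δ₁ x (λ i → i) (λ y → h (y ∷ mask S w)) λ y → ≈-trans
        (∑-cong (masks S) (λ u → *-assoc _ _ _))
        (≈-trans (∑-*ˡ (δ₁ y x) (masks S) _) (*-congˡ (∑-δ S w (λ u → h (y ∷ u))))))
    ∑-δ (outside ∷ S) (x ∷ w) h = ≈-trans
      (reflexive (∑-map (o ∷_) (masks S) _))
      (≈-trans (∑-cong (masks S) (λ u → *-congʳ (≈-trans (*-congʳ (reflexive (δ₁-refl o))) (*-identityˡ _))))
        (∑-δ S w (λ u → h (o ∷ u))))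

    -- A rank-one summand of X_α, its tag being α.
    record Term (k : ℕ) : Set c where
      constructor term
      field
        tag        : Vec (Fin 2) k
        left right : Tensor F n (suc k ℕ.* 2)

    open Term

    -- Both factors of a term take full tuples; it is the masking that restricts one to rows and the
    -- other to columns. Thus terms multiply without reindexing by the coordinates of a subset.
    eval : Fin 2 → Fin 2 → Term k → Tensor F n (suc k ℕ.* 2)
    eval a b t w = left t (mask S w) * right t (mask (∁ S) w)
      where S = rows a (tag t) b

    IsTermSum : Fin 2 → Fin 2 → Tensor F n (suc k ℕ.* 2) → List (Term k) → Set ℓ₁
    IsTermSum a b T ts = ∀ w → T w ≈ ∑ ts (λ t → eval a b t w)

    module _ (a b : Fin 2) (α : Vec (Fin 2) k) (T : Tensor F n (suc k ℕ.* 2)) where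

      private S = rows a α b

      -- The bounds of rank by the numbers of rows and of columns, made explicit: each row is split
      -- off by its indicator, and dually each column.
      rowTerms columnTerms : List (Term k)
      rowTerms    = List.map (λ u → term α (δ u) (λ v → T (overlay S u v))) (masks S)
      columnTerms = List.map (λ v → term α (λ u → T (overlay (∁ S) v u)) (δ v)) (masks (∁ S))

      rowTerms-sum : IsTermSum a b T rowTerms
      rowTerms-sum w = ≈-sym (begin
        ∑ rowTerms (λ t → eval a b t w)                                       ≡⟨ ∑-map _ (masks S) _ ⟩
        ∑ (masks S) (λ u → δ u (mask S w) * T (overlay S u (mask (∁ S) w)))   ≈⟨ ∑-δ S w (λ u → T (overlay S u (mask (∁ S) w))) ⟩
        T (overlay S (mask S w) (mask (∁ S) w))                               ≡⟨ cong T (overlay-mask S w) ⟩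
        T w                                                                   ∎)

      columnTerms-sum : IsTermSum a b T columnTerms
      columnTerms-sum w = ≈-sym (begin
        ∑ columnTerms (λ t → eval a b t w)
          ≡⟨ ∑-map _ (masks (∁ S)) _ ⟩
        ∑ (masks (∁ S)) (λ v → T (overlay (∁ S) v (mask S w)) * δ v (mask (∁ S) w))
          ≈⟨ ∑-cong (masks (∁ S)) (λ v → *-comm _ _) ⟩
        ∑ (masks (∁ S)) (λ v → δ v (mask (∁ S) w) * T (overlay (∁ S) v (mask S w)))
          ≈⟨ ∑-δ (∁ S) w (λ v → T (overlay (∁ S) v (mask S w))) ⟩
        T (overlay (∁ S) (mask (∁ S) w) (mask S w))
          ≡⟨ cong T (overlay-mask-∁ S w) ⟩
        T w ∎)

      length-rowTerms : length rowTerms ≡ n ℕ.^ ∣ S ∣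
      length-rowTerms = trans (List.length-map _ (masks S)) (length-masks S)

      length-columnTerms : length columnTerms ≡ n ℕ.^ ∣ ∁ S ∣
      length-columnTerms = trans (List.length-map _ (masks (∁ S))) (length-masks (∁ S))

    -- If a ≠ b, then the flattening is unbalanced: one side has only d − 1 coordinates.
    unbalanced : ∀ a b → ¬ a ≡ b → (T : Tensor F n (suc k ℕ.* 2)) →
      Σ[ ts ∈ List (Term k) ] IsTermSum a b T ts × length ts ≡ n ℕ.^ k
    unbalanced 0F 0F a≢b T = contradiction refl a≢b
    unbalanced {k = k} 0F 1F _ T = rowTerms 0F 1F α T , rowTerms-sum 0F 1F α T ,
      trans (length-rowTerms 0F 1F α T) (cong (n ℕ.^_) (∣rows01∣ k))
      where α = Vec.replicate k 0F
    unbalanced {k = k} 1F 0F _ T = columnTerms 1F 0F α T , columnTerms-sum 1F 0F α T ,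
      trans (length-columnTerms 1F 0F α T) (cong (n ℕ.^_) (trans (cong ∣_∣ (∁-rows10 k)) (∣rows01∣ k)))
      where α = Vec.replicate k 1F
    unbalanced 1F 1F a≢b T = contradiction refl a≢b

    -- The base case d = 1. If a = b, the flattening is an n by n matrix; otherwise both positions
    -- lie on one side and a single term suffices, with 1 ≤ n.
    matrixTerms : ∀ a b (T : Tensor F n 2) → Σ[ ts ∈ List (Term 0) ] IsTermSum a b T ts × length ts ℕ.≤ n
    matrixTerms 0F 0F T = rowTerms 0F 0F [] T , rowTerms-sum 0F 0F [] T ,
      ℕ.≤-reflexive (trans (length-rowTerms 0F 0F [] T) (ℕ.^-identityʳ n))
    matrixTerms 1F 1F T = rowTerms 1F 1F [] T , rowTerms-sum 1F 1F [] T ,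
      ℕ.≤-reflexive (trans (length-rowTerms 1F 1F [] T) (ℕ.^-identityʳ n))
    matrixTerms 0F 1F T with ts , sums , len ← unbalanced {k = 0} 0F 1F (λ ()) T =
      ts , sums , ℕ.≤-trans (ℕ.≤-reflexive len) (ℕ.>-nonZero⁻¹ n)
    matrixTerms 1F 0F T with ts , sums , len ← unbalanced {k = 0} 1F 0F (λ ()) T =
      ts , sums , ℕ.≤-trans (ℕ.≤-reflexive len) (ℕ.>-nonZero⁻¹ n)

    -- Products of terms and the induction along the formula

    module _ {e f : ℕ} (c : Fin 2) where

      infixl 7 _⊗_
      _⊗_ : Term e → Term f → Term (e ℕ.+ suc f)
      x ⊗ y = term (tag x Vec.++ c ∷ tag y)
        (λ w → left x (takePairs (suc e) {suc f} w) * left y (dropPairs (suc e) {suc f} w))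
        (λ w → right x (takePairs (suc e) {suc f} w) * right y (dropPairs (suc e) {suc f} w))

      -- The mask of the joint pattern restricts to the masks of the two factors, on rows and on
      -- columns alike. What remains is to regroup four scalars.
      eval-⊗ : ∀ a b x y w → eval a b (x ⊗ y) w ≈
        eval a c x (takePairs (suc e) {suc f} w) * eval c b y (dropPairs (suc e) {suc f} w)
      eval-⊗ a b x y w = ≈-trans
        (reflexive (cong₂ _*_ (cong₂ _*_ (cong (left x) takeS) (cong (left y) dropS))
                              (cong₂ _*_ (cong (right x) take∁S) (cong (right y) drop∁S))))
        (interchange _ _ _ _)
        where
        S = rows a (tag x Vec.++ c ∷ tag y) b
        w₁ = takePairs (suc e) {suc f} w
        w₂ = dropPairs (suc e) {suc f} w
        takeS≡ = takePairs-rows a (tag x) c (tag y) b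
        dropS≡ = dropPairs-rows a (tag x) c (tag y) b
        takeS : takePairs (suc e) {suc f} (mask S w) ≡ mask (rows a (tag x) c) w₁
        takeS = trans (takePairs-mask (suc e) (suc f) S w) (cong (λ R → mask R w₁) takeS≡)
        dropS : dropPairs (suc e) {suc f} (mask S w) ≡ mask (rows c (tag y) b) w₂
        dropS = trans (dropPairs-mask (suc e) (suc f) S w) (cong (λ R → mask R w₂) dropS≡)
        take∁S : takePairs (suc e) {suc f} (mask (∁ S) w) ≡ mask (∁ (rows a (tag x) c)) w₁
        take∁S = trans (takePairs-mask (suc e) (suc f) (∁ S) w)
          (cong (λ R → mask R w₁) (trans (takePairs-map (suc e) {suc f} _ S) (cong ∁ takeS≡)))
        drop∁S : dropPairs (suc e) {suc f} (mask (∁ S) w) ≡ mask (∁ (rows c (tag y) b)) w₂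
        drop∁S = trans (dropPairs-mask (suc e) (suc f) (∁ S) w)
          (cong (λ R → mask R w₂) (trans (dropPairs-map (suc e) {suc f} _ S) (cong ∁ dropS≡)))

      ⊗-sum : ∀ {a b} {T : Tensor F n (suc (e ℕ.+ suc f) ℕ.* 2)} {U V xs ys} →
        (∀ w → T w ≈ U (takePairs (suc e) {suc f} w) * V (dropPairs (suc e) {suc f} w)) →
        IsTermSum a c U xs → IsTermSum c b V ys →
        IsTermSum a b T (cartesianProductWith _⊗_ xs ys)
      ⊗-sum {a} {b} {xs = xs} {ys} T≈ U≈ V≈ w = ≈-trans (T≈ w) (≈-trans (*-cong (U≈ _) (V≈ _))
        (≈-sym (∑-* _⊗_ xs ys (λ x y → eval-⊗ a b x y w))))

    -- The denominator n^d, where d = k + 1, is cleared, which keeps the induction within the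
    -- naturals. The exponent K is free so that a product can raise it by one.
    record Bound (k K : ℕ) (a b : Fin 2) (T : Tensor F n (suc k ℕ.* 2)) (L : ℕ) : Set (c Level.⊔ ℓ₁) where
      constructor bound
      field
        terms     : List (Term k)
        terms-sum : IsTermSum a b T terms
        size      : n ℕ.^ K ℕ.* length terms ℕ.≤ L ℕ.* n ℕ.^ suc k

    bound-cong : ∀ {K a b} {T U : Tensor F n (suc k ℕ.* 2)} {L} → (∀ w → U w ≈ T w) → Bound k K a b T L → Bound k K a b U L
    bound-cong U≈T (bound ts sums size) = bound ts (λ w → ≈-trans (U≈T w) (sums w)) size

    bound-weaken : ∀ {K K′ a b} {T : Tensor F n (suc k ℕ.* 2)} {L L′} → K′ ℕ.≤ K → L ℕ.≤ L′ → Bound k K a b T L → Bound k K′ a b T L′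
    bound-weaken K′≤K L≤L′ (bound ts sums size) = bound ts sums
      (ℕ.≤-trans (ℕ.*-monoˡ-≤ _ (ℕ.^-monoʳ-≤ n K′≤K)) (ℕ.≤-trans size (ℕ.*-monoˡ-≤ _ L≤L′)))

    bound-sum : ∀ {K a b m} {T : Fin m → Tensor F n (suc k ℕ.* 2)} {L : Fin m → ℕ} →
      (∀ i → Bound k K a b (T i) (L i)) → Bound k K a b (λ w → sum (λ i → T i w)) (sumℕ L)
    bound-sum {K = K} {m = zero}  bounds = bound [] (λ w → ≈-refl) (ℕ.≤-reflexive (ℕ.*-zeroʳ (n ℕ.^ K)))
    bound-sum {k = k} {K = K} {m = suc m} {L = L} bounds
      with bound ts sums size ← bounds zero | bound ts′ sums′ size′ ← bound-sum (bounds ∘ suc) =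
      bound (ts ++ ts′)
        (λ w → ≈-trans (+-cong (sums w) (sums′ w)) (≈-sym (∑-++ ts ts′ _)))
        (ℕ.≤-trans (ℕ.≤-reflexive (cong (n ℕ.^ K ℕ.*_) (List.length-++ ts))) (scaled-+ (n ℕ.^ K) _ _ (L zero) _ (n ℕ.^ suc k) size size′))

    module _ {e f : ℕ} {a b : Fin 2} {K L : ℕ} {U : Tensor F n (suc e ℕ.* 2)} {V : Tensor F n (suc f ℕ.* 2)} where

      private
        product : Tensor F n ((suc e ℕ.+ suc f) ℕ.* 2)
        product w = U (takePairs (suc e) {suc f} w) * V (dropPairs (suc e) {suc f} w)

      -- Choosing c ≠ b makes V unbalanced, so n^f terms suffice for it whatever its formula size;
      -- hence L bounds only U.
      bound-⊗ˡ : ∀ c → ¬ c ≡ b → Bound e K a c U L → Bound (e ℕ.+ suc f) (suc K) a b product L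
      bound-⊗ˡ c c≢b (bound xs U≈ size) with ys , V≈ , len ← unbalanced {k = f} c b c≢b V =
        bound (cartesianProductWith (_⊗_ c) xs ys) (⊗-sum c {a} {b} {product} {U} {V} {xs} {ys} (λ w → ≈-refl) U≈ V≈) (ℕ.≤-trans
          (ℕ.≤-reflexive (cong (n ℕ.^ suc K ℕ.*_) (trans (length-cartesianProductWith (_⊗_ c) xs ys) (cong (length xs ℕ.*_) len))))
          (scaled-* n K (length xs) L e f size))

      bound-⊗ʳ : ∀ c → ¬ a ≡ c → Bound f K c b V L → Bound (e ℕ.+ suc f) (suc K) a b product L
      bound-⊗ʳ c a≢c (bound ys V≈ size) with xs , U≈ , len ← unbalanced {k = e} a c a≢c U =
        bound (cartesianProductWith (_⊗_ c) xs ys) (⊗-sum c {a} {b} {product} {U} {V} {xs} {ys} (λ w → ≈-refl) U≈ V≈) (ℕ.≤-trans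
          (ℕ.≤-reflexive (cong (n ℕ.^ suc K ℕ.*_) (trans (length-cartesianProductWith (_⊗_ c) xs ys)
            (trans (cong (ℕ._* length ys) len) (ℕ.*-comm (n ℕ.^ e) (length ys))))))
          (ℕ.≤-trans (scaled-* n K (length ys) L f e size)
            (ℕ.≤-reflexive (cong (λ z → L ℕ.* n ℕ.^ z) (ℕ.+-comm (suc f) (suc e))))))

    -- All a and b are needed together, because the product step calls the induction hypothesis with
    -- one of the bits replaced.
    Bounded : ∀ d → Tensor F (n ℕ.* n) d → ℕ → Set (c Level.⊔ ℓ₁)
    Bounded zero    B L = ⊤
    Bounded (suc k) B L = ∀ a b → Bound k ⌈log₂ suc k ⌉ a b (B ∘ pair (suc k)) L

    bounded-product : ∀ {k} (P : Product F (n ℕ.* n) (suc k)) {x y} →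
      Bounded (Product.e P) (Product.B P) x → Bounded (Product.f P) (Product.C P) y →
      Bounded (suc k) (Product.B⊗C P) (x ℕ.+ y)
    bounded-product record { e = suc e ; f = suc f ; e+f≡k = refl ; B = B ; C = C } {x} {y} B≤ C≤ a b =
      bound-cong B⊗C≈ (go (ℕ.≤-total (suc f) (suc e)))
      where
      product : Tensor F n ((suc e ℕ.+ suc f) ℕ.* 2)
      product w = B (pair (suc e) (takePairs (suc e) {suc f} w)) * C (pair (suc f) (dropPairs (suc e) {suc f} w))
      other : Fin 2 → Fin 2
      other 0F = 1F
      other 1F = 0F
      ≢other : ∀ a → ¬ a ≡ other a
      ≢other 0F ()
      ≢other 1F ()
      B⊗C≈ : ∀ w → let v = Vec.cast refl (pair (suc e ℕ.+ suc f) w) in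
        B (Vec.take (suc e) v) * C (Vec.drop (suc e) v) ≈ product w
      B⊗C≈ w = reflexive (cong₂ _*_
        (cong B (trans (cong (Vec.take (suc e)) v≡) (take-pair (suc e) (suc f) w)))
        (cong C (trans (cong (Vec.drop (suc e)) v≡) (drop-pair (suc e) (suc f) w))))
        where v≡ = Vec.cast-is-id refl (pair (suc e ℕ.+ suc f) w)
      -- Here g stands for the larger of the two orders, so the total order is at most 2g.
      log≤ : ∀ {g} .{{_ : NonZero g}} → suc e ℕ.+ suc f ℕ.≤ g ℕ.+ g → ⌈log₂ suc e ℕ.+ suc f ⌉ ℕ.≤ suc ⌈log₂ g ⌉
      log≤ {g} le = ℕ.≤-trans (⌈log₂⌉-mono-≤ (ℕ.≤-trans le (ℕ.≤-reflexive (cong (g ℕ.+_) (sym (ℕ.+-identityʳ g))))))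
        (ℕ.≤-reflexive (⌈log₂2*n⌉≡1+⌈log₂n⌉ g))
      go : suc f ℕ.≤ suc e ⊎ suc e ℕ.≤ suc f → Bound (e ℕ.+ suc f) ⌈log₂ suc e ℕ.+ suc f ⌉ a b product (x ℕ.+ y)
      -- The factor of larger order carries the induction, and the bit next to the smaller factor is
      -- chosen opposite to its outer bit.
      go (inj₁ f≤e) = bound-weaken (log≤ (ℕ.+-monoʳ-≤ (suc e) f≤e)) (ℕ.m≤m+n x y)
        (bound-⊗ˡ {V = C ∘ pair (suc f)} (other b) (≢other b ∘ sym) (B≤ a (other b)))
      go (inj₂ e≤f) = bound-weaken (log≤ (ℕ.+-monoˡ-≤ (suc f) e≤f)) (ℕ.m≤n+m y x)
        (bound-⊗ʳ {U = B ∘ pair (suc e)} (other a) (≢other a) (C≤ (other a) b))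

    size⇒bounded : ∀ d (rs : Acc ℕ._<_ d) (B : Tensor F (n ℕ.* n) d) L → IsSize′ F d rs B L → Bounded d B L
    size⇒bounded zero rs B L _ = tt
    size⇒bounded (suc zero) rs B _ (lift (inj₁ (_ , refl))) a b
      with ts , sums , len ← matrixTerms a b (B ∘ pair 1) = bound ts sums
      (ℕ.≤-trans (ℕ.≤-reflexive (ℕ.*-identityˡ _)) (ℕ.≤-trans len
        (ℕ.≤-reflexive (sym (trans (ℕ.*-identityˡ _) (ℕ.^-identityʳ n))))))
    size⇒bounded (suc zero) rs B _ (lift (inj₂ (B≈0 , refl))) a b = bound [] (λ w → B≈0 (pair 1 w)) z≤n
    size⇒bounded (suc (suc k)) (acc rs) B _ ((m , P , x , y , B≈ , sizes , refl) , _) a b =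
      -- All products have the same order, hence the same exponent, so their bounds add up.
      bound-cong (λ w → B≈ (pair (suc (suc k)) w)) (bound-sum λ i → let open Product (P i) renaming (B to Bᵢ; C to Cᵢ) in
        bounded-product (P i) (size⇒bounded e (rs e<k) Bᵢ (x i) (proj₁ (sizes i)))
          (size⇒bounded f (rs f<k) Cᵢ (y i) (proj₂ (sizes i))) a b)

    -- From lists of terms to relative ranks

    module _ (a b : Fin 2) (ts : List (Term k)) where

      private
        withTag : Vec (Fin 2) k → List (Term k)
        withTag α = filter (λ t → tag t ≟ᵇ α) ts

        component : Vec (Fin 2) k → Tensor F n (suc k ℕ.* 2)
        component α w = ∑ (withTag α) (λ t → eval a b t w)

      -- Terms with the same tag share one flattening, in which each of them is a column vector
      -- times a row vector. The value o fills the coordinates that the mask has erased.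
      component-rank≤ : ∀ α r σ → IndependentColumns F (Mat F (I (suc k) a α b) (component α)) r σ → r ℕ.≤ length (withTag α)
      component-rank≤ α = independent⇒≤ (withTag α)
        (λ t u → left t (merge S u (Vec.replicate _ o)))
        (λ t v → right t (merge S (Vec.replicate _ o) v))
        (λ u v → ∑-cong-All (All.map (λ {t} tag≡α → eval-merge u v t (trans (cong (λ β → rows a β b) tag≡α) (sym (I≡rows k a α b))))
          (all-filter (λ t → tag t ≟ᵇ α) ts)))
        where
        S = I (suc k) a α b
        eval-merge : ∀ u v t → rows a (tag t) b ≡ S → eval a b t (merge S u v) ≈
          left t (merge S u (Vec.replicate _ o)) * right t (merge S (Vec.replicate _ o) v)
        eval-merge u v t eq = reflexive (cong₂ _*_
          (cong (left t) (trans (cong (λ R → mask R (merge S u v)) eq) (mask-merge S u v)))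
          (cong (right t) (trans (cong (λ R → mask (∁ R) (merge S u v)) eq) (mask-∁-merge S u v))))

      -- The components form one admissible decomposition, and their ranks add up to at most the
      -- number of terms. The ranks exist only up to double negation, which is harmless because the
      -- order on the rationals is decidable.
      minimum≤ : ∀ {A : Tensor F n (suc k ℕ.* 2)} K L → IsTermSum a b A ts → n ℕ.^ K ℕ.* length ts ℕ.≤ L ℕ.* n ℕ.^ suc k →
        ∀ x → IsMinimum ℚ._≤_ (IsRelrkSum F (suc k) a b A) x → (+ (n ℕ.^ K) / 1) ℚ.* x ℚ.≤ + L / 1
      minimum≤ K L A≈ size x (_ , x-min) = decidable-stable (_ ℚ.≤? _) λ ¬le →
        -- The empty family of columns is independent, which starts the search for the rank.
        ¬¬-∀bits (λ α → ¬¬-maximum (length (withTag α)) ((λ ()) , λ _ _ ()) (λ r (σ , indep) → component-rank≤ α r σ indep))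
          λ ranks → ¬le (let r = proj₁ ∘ ranks in ℚ.≤-trans
            (ℚ.*-monoˡ-≤-nonNeg (+ (n ℕ.^ K) / 1) {{ℚ.nonNegative (0≤/ (n ℕ.^ K) 1)}} (ℚ.≤-trans
              (x-min _ (component , _ , (λ w → ≈-trans (A≈ w) (≈-sym (∑-byTag tag ts _))) , (λ α → r α , proj₂ (ranks α) , refl) , refl))
              (ℚ.≤-reflexive (sumBits-/ (n ℕ.^ suc k) r (λ α → refl)))))
            (*-/-≤ (n ℕ.^ K) _ L (n ℕ.^ suc k) (ℕ.≤-trans
              (ℕ.*-monoʳ-≤ (n ℕ.^ K) (ℕ.≤-trans
                (sumBits-mono-≤ (λ α → component-rank≤ α _ _ (proj₂ (proj₁ (proj₂ (ranks α))))))
                (ℕ.≤-reflexive (length-byTag tag ts))))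
              size)))
        where
        instance _ = ℕ.m^n≢0 n (suc k)

    -- Supplies the nonnegativity of ρ that raising to q-th powers requires.
    0≤relrkSum : ∀ {a b} {A : Tensor F n (suc k ℕ.* 2)} {x} → IsRelrkSum F (suc k) a b A x → 0ℚ ℚ.≤ x
    0≤relrkSum {k = k} (_ , _ , _ , relrks , refl) = ℚ.≤-trans (0≤/ (sumBits ℕ._+_ (proj₁ ∘ relrks)) (n ℕ.^ suc k))
      (ℚ.≤-reflexive (sym (sumBits-/ (n ℕ.^ suc k) (proj₁ ∘ relrks) (λ α → proj₂ (proj₂ (relrks α))))))
      where
      instance _ = ℕ.m^n≢0 n (suc k)

open import Data.Nat.Base using (_*_)

theorem4p11 : ∀ {c ℓ₁ ℓ₂} (F : HeytingField c ℓ₁ ℓ₂) (n d : ℕ) .{{_ : NonZero n}} .{{_ : NonZero d}} (A : Tensor F n (d * 2)) (L : ℕ) (ρ : ℚ) →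
    IsSize F (flat F d A) L → Isρ F d A ρ → n ^log₂ d · ρ ≤ (+ L / 1)
theorem4p11 F n zero    A L ρ (lift ()) _
theorem4p11 F n (suc k) A L _ size (x , minimum , refl) =
  ^⌈log₂⌉⇒^log₂ n (suc k)
    (⊔-pres (λ z → 0ℚ ℚ.≤ z) (λ a b → 0≤relrkSum F o {a = a} {b = b} (proj₁ (minimum a b))))
    (⊔-pres (λ z → (+ (n ℕ.^ ⌈log₂ suc k ⌉) / 1) ℚ.* z ℚ.≤ + L / 1) x≤)
  where
  -- Since n ≥ 1 there is a coordinate value to mask with.
  o = Fin.fromℕ< (ℕ.>-nonZero⁻¹ n)
  x≤ : ∀ a b → (+ (n ℕ.^ ⌈log₂ suc k ⌉) / 1) ℚ.* x a b ℚ.≤ + L / 1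
  x≤ a b with bound ts sums le ← size⇒bounded F o (suc k) (<-wellFounded (suc k)) (flat F (suc k) A) L size a b =
    minimum≤ F o a b ts ⌈log₂ suc k ⌉ L (λ w → ≈-trans (reflexive (cong A (sym (unpair-pair (suc k) w)))) (sums w)) le (x a b) (minimum a b)
    where open CommutativeRing (HeytingCommutativeRing.commutativeRing (HeytingField.heytingCommutativeRing F)) using (reflexive) renaming (trans to ≈-trans)
  -- The maximum is one of its four arguments, so any property that all of them have passes to ρ.
  ⊔-pres : (Q : ℚ → Set) → (∀ a b → Q (x a b)) → Q ((x 0F 0F ℚ.⊔ x 0F 1F) ℚ.⊔ (x 1F 0F ℚ.⊔ x 1F 1F))
  ⊔-pres Q q = either (either (q 0F 0F) (q 0F 1F)) (either (q 1F 0F) (q 1F 1F))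
    where
    either : ∀ {y z} → Q y → Q z → Q (y ℚ.⊔ z)
    either {y} {z} qy qz with ℚ.⊔-sel y z
    ... | inj₁ eq = subst Q (sym eq) qy
    ... | inj₂ eq = subst Q (sym eq) qz
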